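{- Let $d\ge s\ge 1$ be integers and let $L$ be a $\Diamond$-lattice of rank $d+1$ that has exactly $d+s$ atoms. For $k\ge -1$ let $f_k(L)$ denote the number of elements of $L$ of rank $k+1$. Then for every integer $k$ with $-1\le k\le d$, $$f_k(L)\ \ge\ \phi_k(d+s,d):=\binom{d+1}{k+1}+\binom{d}{k+1}-\binom{d+1-s}{k+1}.$$
   Context: All posets are finite, graded (all maximal chains have the same length) and bounded, with bottom element $\hat 0$ and top element $\hat 1$. The rank function $\rho$ satisfies $\rho(\hat 0)=0$, and the rank of $L$ is $\rho(\hat 1)$. A lattice is a poset in which every pair of elements has a least upper bound and a greatest lower bound. For $x\le y$, the interval $[x,y]$ is $\{z: x\le z\le y\}$ and its rank is $\rho(y)-\rho(x)$. A diamond lattice, or $\Diamond$-lattice, is a (finite, bounded) graded lattice all of whose rank-$2$ intervals have exactly four elements. Atoms are the elements of rank $1$. The convention $\binom{n}{j}=0$ for $0\le n<j$ is used. -}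

module Defs where

open import Level using (Level; suc; _⊔_)
open import Data.Fin.Base using (Fin)
open import Data.Fin.Subset using (Subset; _∈_; _⊆_; ∣_∣)
import Data.Fin.Properties as Fin
open import Data.Integer.Base as ℤ using (ℤ; +_; 1ℤ)
import Data.Integer.Properties as ℤ
open import Data.List.Base using (allFin; filter; length)
open import Data.Nat.Base as ℕ using (ℕ; _+_; _∸_)
open import Data.Nat.Combinatorics using (_C_)
import Data.Nat.Properties as ℕ
open import Data.Product.Base using (_×_; _,_)
open import Data.Sum.Base using (_⊎_)
open import Function.Bundles using (Inverse)
open import Function.Properties.Inverse using (Inverse⇒Injection)
open import Relation.Binary.Definitions using (Decidable)
open import Relation.Binary.Lattice using (BoundedLattice)
import Relation.Binary.Construct.NonStrictToStrict as Strict
open import Relation.Binary.PropositionalEquality using (_≡_)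
import Relation.Binary.PropositionalEquality as ≡
open import Relation.Nullary using (¬_)
open import Relation.Nullary.Decidable using (map′; via-injection; _×-dec_)
import Relation.Unary as U

record FiniteLattice (c ℓ₁ ℓ₂ : Level) : Set (suc (c ⊔ ℓ₁ ⊔ ℓ₂)) where
  field
    boundedLattice : BoundedLattice c ℓ₁ ℓ₂

  open BoundedLattice boundedLattice public

  field
    size        : ℕ
    enumeration : Inverse setoid (≡.setoid (Fin size))

  index : Carrier → Fin size
  index = Inverse.to enumeration

  element : Fin size → Carrier
  element = Inverse.from enumeration

  _≈?_ : Decidable _≈_
  _≈?_ = via-injection (Inverse⇒Injection enumeration) Fin._≟_

  _≤?_ : Decidable _≤_
  x ≤? y = map′
    (λ x∨y≈y → trans (x≤x∨y x y) (reflexive x∨y≈y))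
    (λ x≤y → antisym (∨-least x≤y refl) (y≤x∨y x y))
    ((x ∨ y) ≈? y)

  -- Elements are counted up to _≈_; this is meaningful for predicates
  -- respecting _≈_.
  card : ∀ {p} {P : U.Pred Carrier p} → U.Decidable P → ℕ
  card P? = length (filter (λ i → P? (element i)) (allFin size))

  infix 4 _<_ _⋖_

  _<_ : Carrier → Carrier → Set (ℓ₁ ⊔ ℓ₂)
  _<_ = Strict._<_ _≈_ _≤_

  _⋖_ : Carrier → Carrier → Set (c ⊔ ℓ₁ ⊔ ℓ₂)
  x ⋖ y = x < y × (∀ z → ¬ (x < z × z < y))

  -- Subsets of the lattice are represented by the indices of their elements.
  IsChain : Subset size → Set ℓ₂
  IsChain C = ∀ {i j} → i ∈ C → j ∈ C →
              element i ≤ element j ⊎ element j ≤ element i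

  IsMaximalChain : Subset size → Set ℓ₂
  IsMaximalChain C = IsChain C × (∀ D → IsChain D → C ⊆ D → D ⊆ C)

  -- Maximal chains contain ⊥, so the truncated subtraction is harmless there.
  chainLength : Subset size → ℕ
  chainLength C = ∣ C ∣ ∸ 1

  IsGraded : Set ℓ₂
  IsGraded = ∀ C D → IsMaximalChain C → IsMaximalChain D →
             chainLength C ≡ chainLength D

  -- On a graded lattice there is exactly one such function (up to pointwise
  -- equality): ρ x is the length of every maximal chain of [ ⊥ , x ].
  record IsRankFunction (ρ : Carrier → ℕ) : Set (c ⊔ ℓ₁ ⊔ ℓ₂) where
    field
      ρ-cong : ∀ {x y} → x ≈ y → ρ x ≡ ρ y
      ρ-⊥    : ρ ⊥ ≡ 0
      ρ-⋖    : ∀ {x y} → x ⋖ y → ρ y ≡ ℕ.suc (ρ x)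

record GradedLattice (c ℓ₁ ℓ₂ : Level) : Set (suc (c ⊔ ℓ₁ ⊔ ℓ₂)) where
  field
    finiteLattice : FiniteLattice c ℓ₁ ℓ₂

  open FiniteLattice finiteLattice public

  field
    graded         : IsGraded
    ρ              : Carrier → ℕ
    isRankFunction : IsRankFunction ρ

  open IsRankFunction isRankFunction public

  rank : ℕ
  rank = ρ ⊤

  atomCount : ℕ
  atomCount = card (λ x → ρ x ℕ.≟ 1)

  f : ℤ → ℕ
  f k = card (λ x → + ρ x ℤ.≟ k ℤ.+ 1ℤ)

  intervalRank : Carrier → Carrier → ℕ
  intervalRank x y = ρ y ∸ ρ x

  intervalCard : Carrier → Carrier → ℕ
  intervalCard x y = card (λ z → (x ≤? z) ×-dec (z ≤? y))

record DiamondLattice (c ℓ₁ ℓ₂ : Level) : Set (suc (c ⊔ ℓ₁ ⊔ ℓ₂)) where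
  field
    gradedLattice : GradedLattice c ℓ₁ ℓ₂

  open GradedLattice gradedLattice public

  field
    diamond : ∀ {x y} → x ≤ y → intervalRank x y ≡ 2 → intervalCard x y ≡ 4

-- φ k d s is φ_k(d + s, d), for -1 ≤ k and 1 ≤ s ≤ d.  In this range k + 1 is
-- nonnegative, so ∣ k + 1 ∣ is k + 1 itself, and neither subtraction
-- truncates: d + 1 - s ≤ d bounds the last binomial coefficient by the second.
φ : ℤ → ℕ → ℕ → ℕ
φ k d s = (((d + 1) C j) + (d C j)) ∸ (((d + 1) ∸ s) C j)
  where
  j : ℕ
  j = ℤ.∣ k ℤ.+ 1ℤ ∣

{-# OPTIONS --safe #-}

-- Split the elements of rank k + 1 along a coatom F.  Every K ≤ F is G ∧ F for
-- some G ≰ F of rank one more, so f_k(L) ≥ f_k(F) + f_{k-1}(F); in particular a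
-- diamond lattice of rank r has at least r C j elements of rank j.  Moreover,
-- given m atoms, the i-th one lies below an element F_i of rank at least
-- d + 2 - i that avoids the previous ones, so at least
-- Σ_{i=1}^m (d + 1 - i) C k elements of rank k + 1 lie above one of the atoms.
-- By induction on d, the first bound gives the theorem if F misses just one
-- atom, and the second one, applied to the atoms F misses, if it misses more.
module Submission where

open import Defs
open import Level using (Level)
open import Data.Fin.Base using (Fin)
import Data.Fin.Properties as Fin
open import Data.Integer.Base as ℤ using (ℤ; +_; -1ℤ; -[1+_])
import Data.Integer.Properties as ℤ
open import Data.List.Base using (List; []; _∷_; _++_; length; filter; map; allFin)
import Data.List.Properties as List
open import Data.List.Membership.Propositional using (_∈_)
open import Data.List.Membership.Propositional.Properties
  using (∈-∃++; ∈-++⁺ˡ; ∈-++⁺ʳ; ∈-++⁻; ∈-filter⁺; ∈-filter⁻; ∈-allFin; ∈-map⁺)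
open import Data.List.Relation.Unary.All as All using (All; []; _∷_)
import Data.List.Relation.Unary.All.Properties as All
open import Data.List.Relation.Unary.AllPairs as AllPairs using (AllPairs; []; _∷_)
import Data.List.Relation.Unary.AllPairs.Properties as AllPairs
open import Data.List.Relation.Unary.Any using (Any; here; there; any?)
open import Data.List.Relation.Unary.Unique.Propositional using (Unique)
import Data.List.Relation.Unary.Unique.Propositional.Properties as Unique
open import Data.Nat.Base using (ℕ; zero; suc; _+_; _∸_; _≤_; _<_; _≥_; z≤n; s≤s; s≤s⁻¹)
open import Data.Nat.Combinatorics using (_C_; nC1≡n; nCk+nC[k+1]≡[n+1]C[k+1])
import Data.Nat.Properties as ℕ
open import Data.Nat.Tactic.RingSolver using (solve-∀)
open import Data.Product.Base using (∃; _×_; _,_; proj₁; proj₂)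
open import Data.Sum.Base using (_⊎_; inj₁; inj₂; [_,_]′)
open import Function.Base using (_∘_)
open import Function.Bundles using (Inverse)
open import Relation.Binary.Bundles using (Setoid)
open import Relation.Binary.Definitions using (_Respects_)
open import Relation.Binary.PropositionalEquality
  using (_≡_; refl; sym; trans; cong; cong₂; subst; subst₂)
open import Relation.Nullary using (¬_; Dec; yes; no; contradiction)
open import Relation.Nullary.Decidable using (map′; ¬?; _×-dec_)
open import Relation.Unary using (Pred; Decidable)

-- Binomial sums

suc-∸-≤ : ∀ m n → suc m ∸ n ≤ suc (m ∸ n)
suc-∸-≤ m       zero    = ℕ.≤-refl
suc-∸-≤ zero    (suc n) = ℕ.≤-trans (ℕ.m∸n≤m 0 n) z≤n
suc-∸-≤ (suc m) (suc n) = suc-∸-≤ m n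

C-monoˡ : ∀ k {m n} → m ≤ n → m C k ≤ n C k
C-monoˡ zero    _   = ℕ.≤-refl
C-monoˡ (suc k) m≤n = go (ℕ.≤⇒≤′ m≤n)
  where
  open import Data.Nat.Base using (_≤′_; ≤′-refl; ≤′-step)
  go : ∀ {m n} → m ≤′ n → m C suc k ≤ n C suc k
  go ≤′-refl = ℕ.≤-refl
  go (≤′-step {n} m≤′n) = ℕ.≤-trans (go m≤′n)
    (subst (n C suc k ≤_) (nCk+nC[k+1]≡[n+1]C[k+1] n k) (ℕ.m≤n+m _ _))

-- ∑C d k m = Σ_{j<m} (d ∸ j) C k, so that φ_k(d + s, d) = d C (k + 1) + ∑C d k s
-- for s ≤ d + 1.  Beyond j = d the subtraction truncates, and the summand is
-- 0 C k: the lower bounds below stay valid, being equalities for k = 0.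
∑C : ℕ → ℕ → ℕ → ℕ
∑C d k zero    = 0
∑C d k (suc m) = ∑C d k m + (d ∸ m) C k

∑C-k≡0 : ∀ d m → ∑C d 0 m ≡ m
∑C-k≡0 d zero    = refl
∑C-k≡0 d (suc m) = trans (cong (_+ 1) (∑C-k≡0 d m)) (ℕ.+-comm m 1)

∑C-d≡0 : ∀ k m → ∑C 0 (suc k) m ≡ 0
∑C-d≡0 k zero    = refl
∑C-d≡0 k (suc m) rewrite ℕ.0∸n≡0 m | ∑C-d≡0 k m = refl

∑C-monoʳ : ∀ d k {m n} → m ≤ n → ∑C d k m ≤ ∑C d k n
∑C-monoʳ d k {m} m≤n with ℕ.m≤n⇒∃[o]m+o≡n m≤n
... | o , refl = go o
  where
  go : ∀ o → ∑C d k m ≤ ∑C d k (m + o)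
  go zero    rewrite ℕ.+-identityʳ m = ℕ.≤-refl
  go (suc o) rewrite ℕ.+-suc m o = ℕ.≤-trans (go o) (ℕ.m≤m+n _ _)

-- `suc d ∸ suc m` reduces to `d ∸ m`, so splitting off the leading summand shifts `d` down by one.
∑C-head : ∀ d k m → ∑C (suc d) k (suc m) ≡ suc d C k + ∑C d k m
∑C-head d k zero    = sym (ℕ.+-identityʳ _)
∑C-head d k (suc m) = trans (cong (_+ (d ∸ m) C k) (∑C-head d k m)) (ℕ.+-assoc (suc d C k) _ _)

-- Pascal's rule, summand by summand. At an index `m > d` only an inequality is left, since there
-- `suc d ∸ m` is 0 while `suc (d ∸ m)` is 1.
∑C-pascal : ∀ d k m → ∑C (suc d) (suc k) m ≤ ∑C d (suc k) m + ∑C d k m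
∑C-pascal d k zero    = z≤n
∑C-pascal d k (suc m) = begin
  ∑C (suc d) (suc k) m + (suc d ∸ m) C suc k
    ≤⟨ ℕ.+-mono-≤ (∑C-pascal d k m) term ⟩
  (∑C d (suc k) m + ∑C d k m) + ((d ∸ m) C suc k + (d ∸ m) C k)
    ≡⟨ interchange (∑C d (suc k) m) _ _ _ ⟩
  (∑C d (suc k) m + (d ∸ m) C suc k) + (∑C d k m + (d ∸ m) C k) ∎
  where
  open ℕ.≤-Reasoning
  interchange : ∀ a b c e → (a + b) + (c + e) ≡ (a + c) + (b + e)
  interchange = solve-∀
  term : (suc d ∸ m) C suc k ≤ (d ∸ m) C suc k + (d ∸ m) C k
  term = begin
    (suc d ∸ m) C suc k             ≤⟨ C-monoˡ (suc k) (suc-∸-≤ d m) ⟩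
    suc (d ∸ m) C suc k             ≡⟨ nCk+nC[k+1]≡[n+1]C[k+1] (d ∸ m) k ⟨
    (d ∸ m) C k + (d ∸ m) C suc k   ≡⟨ ℕ.+-comm ((d ∸ m) C k) _ ⟩
    (d ∸ m) C suc k + (d ∸ m) C k   ∎

-- The summands decrease, so the t summands counted from index suc p on are
-- dominated by those of index 1 , … , t.
∑C-split : ∀ d k t p → d C k + ∑C d k (t + suc p) ≤ ∑C d k (suc t) + ∑C d k (suc p)
∑C-split d k zero    p = ℕ.≤-refl
∑C-split d k (suc t) p = begin
  d C k + (∑C d k (t + suc p) + (d ∸ (t + suc p)) C k)
    ≡⟨ ℕ.+-assoc (d C k) _ _ ⟨
  (d C k + ∑C d k (t + suc p)) + (d ∸ (t + suc p)) C k
    ≤⟨ ℕ.+-mono-≤ (∑C-split d k t p) (C-monoˡ k (ℕ.∸-monoʳ-≤ d suc-t≤)) ⟩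
  (∑C d k (suc t) + ∑C d k (suc p)) + (d ∸ suc t) C k
    ≡⟨ swap (∑C d k (suc t)) _ _ ⟩
  (∑C d k (suc t) + (d ∸ suc t) C k) + ∑C d k (suc p) ∎
  where
  open ℕ.≤-Reasoning
  swap : ∀ a b c → (a + b) + c ≡ (a + c) + b
  swap = solve-∀
  suc-t≤ : suc t ≤ t + suc p
  suc-t≤ = subst (suc t ≤_) (sym (ℕ.+-suc t p)) (s≤s (ℕ.m≤m+n t p))

-- Pascal's rule splits off one summand at a time; `s ≤ suc d` keeps the upper entry from
-- truncating.
∑C-telescope : ∀ d k {s} → s ≤ suc d → suc d C suc k ≡ ∑C d k s + (suc d ∸ s) C suc k
∑C-telescope d k {zero}  _         = refl
∑C-telescope d k {suc s} (s≤s s≤d) = begin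
  suc d C suc k                                   ≡⟨ ∑C-telescope d k (ℕ.m≤n⇒m≤1+n s≤d) ⟩
  ∑C d k s + (suc d ∸ s) C suc k                  ≡⟨ cong (λ n → ∑C d k s + n C suc k) (ℕ.+-∸-assoc 1 s≤d) ⟩
  ∑C d k s + suc (d ∸ s) C suc k                  ≡⟨ cong (λ n → ∑C d k s + n) (nCk+nC[k+1]≡[n+1]C[k+1] (d ∸ s) k) ⟨
  ∑C d k s + ((d ∸ s) C k + (d ∸ s) C suc k)      ≡⟨ ℕ.+-assoc (∑C d k s) _ _ ⟨
  (∑C d k s + (d ∸ s) C k) + (d ∸ s) C suc k      ∎
  where open Relation.Binary.PropositionalEquality.≡-Reasoning

-- Counting by lists of indices

-- The pigeonhole principle: by uniqueness, cutting the head of `xs` out of `ys` leaves a list that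
-- still contains the tail of `xs`. The counting lemmas below rest on it.
Unique-⊆⇒length≤ : ∀ {a} {A : Set a} {xs ys : List A} →
  Unique xs → (∀ {x} → x ∈ xs → x ∈ ys) → length xs ≤ length ys
Unique-⊆⇒length≤ []          _     = z≤n
Unique-⊆⇒length≤ {xs = x ∷ xs} (x∉xs ∷ xs!) xs⊆ys with ∈-∃++ (xs⊆ys (here refl))
... | as , bs , refl = begin
  suc (length xs)              ≤⟨ s≤s (Unique-⊆⇒length≤ xs! xs⊆as++bs) ⟩
  suc (length (as ++ bs))      ≡⟨ cong suc (List.length-++ as) ⟩
  suc (length as + length bs)  ≡⟨ ℕ.+-suc (length as) _ ⟨
  length as + suc (length bs)  ≡⟨ List.length-++ as ⟨
  length (as ++ x ∷ bs)        ∎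
  where
  open ℕ.≤-Reasoning
  xs⊆as++bs : ∀ {z} → z ∈ xs → z ∈ as ++ bs
  xs⊆as++bs z∈xs with ∈-++⁻ as (xs⊆ys (there z∈xs))
  ... | inj₁ z∈as         = ∈-++⁺ˡ z∈as
  ... | inj₂ (here refl)  = contradiction refl (All.lookup x∉xs z∈xs)
  ... | inj₂ (there z∈bs) = ∈-++⁺ʳ as z∈bs

module Counting {c ℓ₁ ℓ₂} (F : FiniteLattice c ℓ₁ ℓ₂) where
  open FiniteLattice F using (Carrier; _≈_; _≈?_; setoid; size; enumeration; index; element; card)
  open Inverse enumeration using (strictlyInverseˡ; strictlyInverseʳ; to-cong)
  open Setoid setoid using () renaming (refl to ≈-refl; sym to ≈-sym; trans to ≈-trans)

  indices : ∀ {p} {P : Pred Carrier p} → Decidable P → List (Fin size)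
  indices P? = filter (λ i → P? (element i)) (allFin size)

  indices-unique : ∀ {p} {P : Pred Carrier p} (P? : Decidable P) → Unique (indices P?)
  indices-unique P? = Unique.filter⁺ (λ i → P? (element i)) (Unique.allFin⁺ size)

  ∈-indices⁺ : ∀ {p} {P : Pred Carrier p} (P? : Decidable P) {i} →
    P (element i) → i ∈ indices P?
  ∈-indices⁺ P? = ∈-filter⁺ (λ i → P? (element i)) (∈-allFin _)

  ∈-indices⁻ : ∀ {p} {P : Pred Carrier p} (P? : Decidable P) {i} →
    i ∈ indices P? → P (element i)
  ∈-indices⁻ P? i∈ = proj₂ (∈-filter⁻ (λ i → P? (element i)) {xs = allFin size} i∈)

  element-injective : ∀ {i j} → element i ≈ element j → i ≡ j
  element-injective {i} {j} e = trans (sym (strictlyInverseˡ i)) (trans (to-cong e) (strictlyInverseˡ j))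

  ∃? : ∀ {p} {P : Pred Carrier p} → P Respects _≈_ → Decidable P → Dec (∃ P)
  ∃? resp P? = map′
    (λ (i , Pi) → element i , Pi)
    (λ (x , Px) → index x , resp (≈-sym (strictlyInverseʳ x)) Px)
    (Fin.any? (λ i → P? (element i)))

  card-+ : ∀ {p q r} {P : Pred Carrier p} {Q : Pred Carrier q} {R : Pred Carrier r}
    (P? : Decidable P) (Q? : Decidable Q) (R? : Decidable R) →
    (∀ {x} → P x → R x) → (∀ {x} → Q x → R x) → (∀ {x} → P x → ¬ Q x) →
    card P? + card Q? ≤ card R?
  card-+ P? Q? R? P⊆R Q⊆R disjoint = begin
    card P? + card Q?                    ≡⟨ List.length-++ (indices P?) ⟨
    length (indices P? ++ indices Q?)    ≤⟨ Unique-⊆⇒length≤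
      (Unique.++⁺ (indices-unique P?) (indices-unique Q?)
        (λ (i∈P , i∈Q) → disjoint (∈-indices⁻ P? i∈P) (∈-indices⁻ Q? i∈Q)))
      (λ i∈ → ∈-indices⁺ R? ([ P⊆R ∘ ∈-indices⁻ P? , Q⊆R ∘ ∈-indices⁻ Q? ]′ (∈-++⁻ (indices P?) i∈))) ⟩
    card R?                              ∎
    where open ℕ.≤-Reasoning

  card-∪ : ∀ {p q r} {P : Pred Carrier p} {Q : Pred Carrier q} {R : Pred Carrier r}
    (P? : Decidable P) (Q? : Decidable Q) (R? : Decidable R) →
    (∀ {x} → R x → P x ⊎ Q x) → card R? ≤ card P? + card Q?
  card-∪ P? Q? R? R⊆P∪Q = ℕ.≤-trans
    (Unique-⊆⇒length≤ (indices-unique R?) λ i∈ →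
      [ ∈-++⁺ˡ ∘ ∈-indices⁺ P? , ∈-++⁺ʳ (indices P?) ∘ ∈-indices⁺ Q? ]′ (R⊆P∪Q (∈-indices⁻ R? i∈)))
    (ℕ.≤-reflexive (List.length-++ (indices P?)))

  card-mono : ∀ {p q} {P : Pred Carrier p} {Q : Pred Carrier q}
    (P? : Decidable P) (Q? : Decidable Q) → (∀ {x} → P x → Q x) → card P? ≤ card Q?
  card-mono P? Q? P⊆Q =
    Unique-⊆⇒length≤ (indices-unique P?) (∈-indices⁺ Q? ∘ P⊆Q ∘ ∈-indices⁻ P?)

  -- The images of `Q` under `g` cover `P`. In `level-step`, `g` is the meet with a coatom.
  card-surjection : ∀ {p q} {P : Pred Carrier p} {Q : Pred Carrier q}
    (P? : Decidable P) (Q? : Decidable Q) → Q Respects _≈_ →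
    (g : Carrier → Carrier) → (∀ {x y} → x ≈ y → g x ≈ g y) →
    (∀ {x} → P x → ∃ λ y → Q y × g y ≈ x) → card P? ≤ card Q?
  card-surjection P? Q? Q-resp g g-cong surj = begin
    card P?                          ≤⟨ Unique-⊆⇒length≤ (indices-unique P?) covered ⟩
    length (map g′ (indices Q?))     ≡⟨ List.length-map g′ (indices Q?) ⟩
    card Q?                          ∎
    where
    open ℕ.≤-Reasoning
    g′ : Fin size → Fin size
    g′ = index ∘ g ∘ element
    covered : ∀ {i} → i ∈ indices P? → i ∈ map g′ (indices Q?)
    covered {i} i∈ with surj (∈-indices⁻ P? i∈)
    ... | y , Qy , gy≈i = subst (_∈ map g′ (indices Q?)) g′y≡i
      (∈-map⁺ g′ (∈-indices⁺ Q? (Q-resp (≈-sym (strictlyInverseʳ y)) Qy)))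
      where
      g′y≡i : g′ (index y) ≡ i
      g′y≡i = trans (to-cong (≈-trans (g-cong (strictlyInverseʳ y)) gy≈i)) (strictlyInverseˡ i)

  card-positive : ∀ {p} {P : Pred Carrier p} (P? : Decidable P) → P Respects _≈_ →
    ∀ {x} → P x → 1 ≤ card P?
  card-positive P? resp {x} Px = Unique-⊆⇒length≤ {xs = index x ∷ []} ([] ∷ [])
    λ { (here refl) → ∈-indices⁺ P? (resp (≈-sym (strictlyInverseʳ x)) Px) }

  card-bounded : ∀ {p} {P : Pred Carrier p} (P? : Decidable P) (xs : List Carrier) →
    (∀ {x} → P x → Any (x ≈_) xs) → card P? ≤ length xs
  card-bounded P? xs P⊆xs = subst (card P? ≤_) (List.length-map index xs)
    (Unique-⊆⇒length≤ (indices-unique P?) (listed ∘ P⊆xs ∘ ∈-indices⁻ P?))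
    where
    listed : ∀ {i ys} → Any (element i ≈_) ys → i ∈ map index ys
    listed {i} (here i≈y)  = here (trans (sym (strictlyInverseˡ i)) (to-cong i≈y))
    listed     (there i∈) = there (listed i∈)

  -- The class of `w` is counted in addition to `P`. This makes the number of elements in between a
  -- decreasing measure for `ρ-mono-<`.
  card-strict : ∀ {p q} {P : Pred Carrier p} {Q : Pred Carrier q}
    (P? : Decidable P) (Q? : Decidable Q) → P Respects _≈_ → Q Respects _≈_ →
    (∀ {x} → P x → Q x) → ∀ {w} → Q w → ¬ P w → card P? < card Q?
  card-strict P? Q? P-resp Q-resp P⊆Q {w} Qw ¬Pw = begin
    suc (card P?)           ≡⟨ ℕ.+-comm 1 _ ⟩
    card P? + 1             ≤⟨ ℕ.+-monoʳ-≤ (card P?)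
                                 (card-positive (w ≈?_) (λ e w≈x → ≈-trans w≈x e) ≈-refl) ⟩
    card P? + card (w ≈?_)  ≤⟨ card-+ P? (w ≈?_) Q? P⊆Q (λ w≈x → Q-resp w≈x Qw)
                                 (λ Px w≈x → ¬Pw (P-resp (≈-sym w≈x) Px)) ⟩
    card Q?                 ∎
    where open ℕ.≤-Reasoning

-- Order and rank

module Diamond {c ℓ₁ ℓ₂} (L : DiamondLattice c ℓ₁ ℓ₂) where
  open DiamondLattice L
    using (Carrier; _≈_; _≈?_; setoid; element; card; _∧_; x∧y≤x; x∧y≤y; ∧-greatest;
           ⊥; minimum; _⋖_; ρ; ρ-cong; ρ-⊥; ρ-⋖; diamond)
    renaming (_≤_ to _⊑_; _<_ to _⊏_; _≤?_ to _⊑?_; refl to ⊑-refl; trans to ⊑-trans;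
              reflexive to ⊑-reflexive; antisym to ⊑-antisym)
  open Setoid setoid using () renaming (refl to ≈-refl; sym to ≈-sym; trans to ≈-trans)
  open Counting (DiamondLattice.finiteLattice L)

  private
    variable
      w x y z F : Carrier

  ⊑-respʳ : ∀ x → (x ⊑_) Respects _≈_
  ⊑-respʳ x y≈z x⊑y = ⊑-trans x⊑y (⊑-reflexive y≈z)

  ⊑-respˡ : ∀ x → (_⊑ x) Respects _≈_
  ⊑-respˡ x y≈z y⊑x = ⊑-trans (⊑-reflexive (≈-sym y≈z)) y⊑x

  ⊏-⊑-trans : x ⊏ y → y ⊑ z → x ⊏ z
  ⊏-⊑-trans (x⊑y , x≉y) y⊑z =
    ⊑-trans x⊑y y⊑z , λ x≈z → x≉y (⊑-antisym x⊑y (⊑-trans y⊑z (⊑-reflexive (≈-sym x≈z))))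

  ⊑-⊏-trans : x ⊑ y → y ⊏ z → x ⊏ z
  ⊑-⊏-trans x⊑y (y⊑z , y≉z) =
    ⊑-trans x⊑y y⊑z , λ x≈z → y≉z (⊑-antisym y⊑z (⊑-trans (⊑-reflexive (≈-sym x≈z)) x⊑y))

  ⊏-irrefl : x ≈ y → ¬ x ⊏ y
  ⊏-irrefl x≈y (_ , x≉y) = x≉y x≈y

  Between : Carrier → Carrier → Pred Carrier _
  Between x y w = x ⊏ w × w ⊏ y

  between? : ∀ x y → Decidable (Between x y)
  between? x y w = (x ⊏? w) ×-dec (w ⊏? y)
    where
    _⊏?_ : ∀ x y → Dec (x ⊏ y)
    x ⊏? y = (x ⊑? y) ×-dec ¬? (x ≈? y)

  between-resp : ∀ x y → Between x y Respects _≈_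
  between-resp x y w≈v (x⊏w , w⊏y) =
    ⊏-⊑-trans x⊏w (⊑-reflexive w≈v) , ⊑-⊏-trans (⊑-reflexive (≈-sym w≈v)) w⊏y

  cover-or-between : x ⊏ y → x ⋖ y ⊎ ∃ (Between x y)
  cover-or-between {x} {y} x⊏y with ∃? (between-resp x y) (between? x y)
  ... | yes ∃w = inj₂ ∃w
  ... | no ∄w  = inj₁ (x⊏y , λ z Bz → ∄w (z , Bz))

  -- The rank axioms compare ranks along covers only. If `y` does not cover `x`, some `w` lies
  -- strictly between; it is between neither `x` and `w` nor `w` and `y`, so induction on the number
  -- of elements in between applies to both halves.
  ρ-mono-< : x ⊏ y → ρ x < ρ y
  ρ-mono-< x⊏y = go _ x⊏y ℕ.≤-refl
    where
    go : ∀ n {x y} → x ⊏ y → card (between? x y) ≤ n → ρ x < ρ y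
    go n {x} {y} x⊏y size≤n with cover-or-between x⊏y
    ... | inj₁ x⋖y = ℕ.≤-reflexive (sym (ρ-⋖ x⋖y))
    ... | inj₂ (w , x⊏w , w⊏y) with n
    ...   | zero  = contradiction
      (ℕ.≤-trans (card-positive (between? x y) (between-resp x y) (x⊏w , w⊏y)) size≤n) λ ()
    ...   | suc m = ℕ.<-trans
      (go m x⊏w (smaller (between? x w) (between-resp x w)
        (λ (x⊏z , z⊏w) → x⊏z , ⊏-⊑-trans z⊏w (proj₁ w⊏y)) (⊏-irrefl ≈-refl ∘ proj₂)))
      (go m w⊏y (smaller (between? w y) (between-resp w y)
        (λ (w⊏z , z⊏y) → ⊑-⊏-trans (proj₁ x⊏w) w⊏z , z⊏y) (⊏-irrefl ≈-refl ∘ proj₁)))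
      where
      smaller : ∀ {p} {P : Pred Carrier p} (P? : Decidable P) → P Respects _≈_ →
        (∀ {z} → P z → Between x y z) → ¬ P w → card P? ≤ m
      smaller P? P-resp P⊆ ¬Pw = s≤s⁻¹ (ℕ.≤-trans
        (card-strict P? (between? x y) P-resp (between-resp x y) P⊆ (x⊏w , w⊏y) ¬Pw) size≤n)

  ρ-mono : x ⊑ y → ρ x ≤ ρ y
  ρ-mono {x} {y} x⊑y with x ≈? y
  ... | yes x≈y = ℕ.≤-reflexive (ρ-cong x≈y)
  ... | no  x≉y = ℕ.<⇒≤ (ρ-mono-< (x⊑y , x≉y))

  ⊑∧ρ≥⇒≈ : x ⊑ y → ρ y ≤ ρ x → x ≈ y
  ⊑∧ρ≥⇒≈ {x} {y} x⊑y ρy≤ρx with x ≈? y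
  ... | yes x≈y = x≈y
  ... | no  x≉y = contradiction ρy≤ρx (ℕ.<⇒≱ (ρ-mono-< (x⊑y , x≉y)))

  ρ<⇒⋢ : ρ x < ρ y → ¬ y ⊑ x
  ρ<⇒⋢ ρx<ρy y⊑x = ℕ.<⇒≱ ρx<ρy (ρ-mono y⊑x)

  -- Subdividing at some `w` strictly between and keeping the half whose ranks enclose `j` ends at
  -- rank `j`, because covers raise the rank by exactly one. The fuel `n` bounds the rank of [x, y].
  interpolate : ∀ {j} → x ⊑ y → ρ x ≤ j → j ≤ ρ y → ∃ λ z → x ⊑ z × z ⊑ y × ρ z ≡ j
  interpolate {x} {y} x⊑y = go (ρ y) x⊑y (ℕ.m≤n+m (ρ y) (ρ x))
    where
    go : ∀ n {x y j} → x ⊑ y → ρ y ≤ ρ x + n → ρ x ≤ j → j ≤ ρ y →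
         ∃ λ z → x ⊑ z × z ⊑ y × ρ z ≡ j
    go n {x} {y} {j} x⊑y ρy≤ ρx≤j j≤ρy with ρ x ℕ.≟ j | ρ y ℕ.≟ j
    ... | yes ρx≡j | _        = x , ⊑-refl , x⊑y , ρx≡j
    ... | no _     | yes ρy≡j = y , x⊑y , ⊑-refl , ρy≡j
    ... | no ρx≢j  | no ρy≢j  with cover-or-between x⊏y
      where
      x⊏y : x ⊏ y
      x⊏y = x⊑y , λ x≈y → ρx≢j (ℕ.≤-antisym ρx≤j (ℕ.≤-trans j≤ρy (ℕ.≤-reflexive (sym (ρ-cong x≈y)))))
    ...   | inj₁ x⋖y = contradiction (ℕ.≤-antisym j≤ρy
      (ℕ.≤-trans (ℕ.≤-reflexive (ρ-⋖ x⋖y)) (ℕ.≤∧≢⇒< ρx≤j ρx≢j))) (ρy≢j ∘ sym)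
    ...   | inj₂ (w , x⊏w , w⊏y) with n
    ...     | zero  = contradiction
      (ℕ.≤-trans ρy≤ (ℕ.≤-reflexive (ℕ.+-identityʳ _))) (ℕ.<⇒≱ (ℕ.<-trans (ρ-mono-< x⊏w) (ρ-mono-< w⊏y)))
    ...     | suc m with ℕ.≤-total j (ρ w)
    ...       | inj₁ j≤ρw = let z , x⊑z , z⊑w , ρz≡j = go m (proj₁ x⊏w) ρw≤ ρx≤j j≤ρw
                            in  z , x⊑z , ⊑-trans z⊑w (proj₁ w⊏y) , ρz≡j
      where
      ρw≤ : ρ w ≤ ρ x + m
      ρw≤ = s≤s⁻¹ (ℕ.≤-trans (ρ-mono-< w⊏y) (ℕ.≤-trans ρy≤ (ℕ.≤-reflexive (ℕ.+-suc (ρ x) m))))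
    ...       | inj₂ ρw≤j = let z , w⊑z , z⊑y , ρz≡j = go m (proj₁ w⊏y) ρy≤′ ρw≤j j≤ρy
                            in  z , ⊑-trans (proj₁ x⊏w) w⊑z , z⊑y , ρz≡j
      where
      ρy≤′ : ρ y ≤ ρ w + m
      ρy≤′ = ℕ.≤-trans ρy≤ (ℕ.≤-trans (ℕ.≤-reflexive (ℕ.+-suc (ρ x) m)) (ℕ.+-monoˡ-≤ m (ρ-mono-< x⊏w)))

  -- Without such a `w`, every element of the rank 2 interval would be `x`, `z` or `y`, against the
  -- four that the diamond property demands.
  fourth-element : x ⊑ z → z ⊑ y → ρ z ≡ suc (ρ x) → ρ y ≡ suc (suc (ρ x)) →
    ∃ λ w → x ⊑ w × w ⊑ y × ρ w ≡ suc (ρ x) × ¬ w ≈ z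
  fourth-element {x} {z} {y} x⊑z z⊑y ρz ρy
    with ∃? {P = λ w → x ⊑ w × w ⊑ y × ρ w ≡ suc (ρ x) × ¬ w ≈ z}
      (λ e (x⊑w , w⊑y , ρw , w≉z) → ⊑-respʳ x e x⊑w , ⊑-respˡ y e w⊑y
        , trans (ρ-cong (≈-sym e)) ρw , λ v≈z → w≉z (≈-trans e v≈z))
      (λ w → (x ⊑? w) ×-dec (w ⊑? y) ×-dec (ρ w ℕ.≟ suc (ρ x)) ×-dec ¬? (w ≈? z))
  ... | yes w = w
  ... | no ∄w = contradiction (subst (_≤ 3) (diamond (⊑-trans x⊑z z⊑y) rank2) three) λ { (s≤s (s≤s (s≤s ()))) }
    where
    rank2 : ρ y ∸ ρ x ≡ 2
    rank2 = trans (cong (_∸ ρ x) ρy) (ℕ.m+n∸n≡m 2 (ρ x))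
    three : card (λ v → (x ⊑? v) ×-dec (v ⊑? y)) ≤ 3
    three = card-bounded (λ v → (x ⊑? v) ×-dec (v ⊑? y)) (x ∷ z ∷ y ∷ []) listed
      where
      listed : ∀ {v} → x ⊑ v × v ⊑ y → Any (v ≈_) (x ∷ z ∷ y ∷ [])
      listed {v} (x⊑v , v⊑y) with v ≈? x | v ≈? z | v ≈? y
      ... | yes v≈x | _       | _       = here v≈x
      ... | no _    | yes v≈z | _       = there (here v≈z)
      ... | no _    | no _    | yes v≈y = there (there (here v≈y))
      ... | no v≉x  | no v≉z  | no v≉y  = contradiction (v , x⊑v , v⊑y , ρv , v≉z) ∄w
        where
        ρv : ρ v ≡ suc (ρ x)
        ρv = ℕ.≤-antisym
          (s≤s⁻¹ (ℕ.≤-trans (ρ-mono-< (v⊑y , v≉y)) (ℕ.≤-reflexive ρy)))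
          (ρ-mono-< (x⊑v , v≉x ∘ ≈-sym))

  -- Levels of intervals

  -- The rank `j` is taken in the whole lattice: [x, y] starts at level `ρ x`.
  InLevel : Carrier → Carrier → ℕ → Pred Carrier _
  InLevel x y j z = x ⊑ z × z ⊑ y × ρ z ≡ j

  level? : ∀ x y j → Decidable (InLevel x y j)
  level? x y j z = (x ⊑? z) ×-dec (z ⊑? y) ×-dec (ρ z ℕ.≟ j)

  level-resp : ∀ x y j → InLevel x y j Respects _≈_
  level-resp x y j e (x⊑w , w⊑y , ρw) =
    ⊑-respʳ x e x⊑w , ⊑-respˡ y e w⊑y , trans (ρ-cong (≈-sym e)) ρw

  level : Carrier → Carrier → ℕ → ℕ
  level x y j = card (level? x y j)

  -- Descend from F: if x ⋖ x′ ⊑ F and G′ ⋢ F covers x′, then x′ = G′ ∧ F is the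
  -- only middle element of the diamond [ x , G′ ] below F, so take the other one.
  cover-outside : F ⊑ y → ρ y ≡ suc (ρ F) → x ⊑ F →
    ∃ λ G → x ⊑ G × G ⊑ y × ρ G ≡ suc (ρ x) × ¬ G ⊑ F
  cover-outside {F} {y} F⊑y ρy x⊑F = go (ρ F) x⊑F (ℕ.m≤n+m (ρ F) _)
    where
    go : ∀ n {x} → x ⊑ F → ρ F ≤ ρ x + n →
         ∃ λ G → x ⊑ G × G ⊑ y × ρ G ≡ suc (ρ x) × ¬ G ⊑ F
    go n {x} x⊑F ρF≤ with ρ F ℕ.≤? ρ x
    -- Here `x` has the same rank as `F`, so `y` itself is the element sought.
    ... | yes ρF≤ρx = y , ⊑-trans x⊑F F⊑y , ⊑-refl
                    , trans ρy (cong suc (ℕ.≤-antisym ρF≤ρx (ρ-mono x⊑F)))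
                    , ρ<⇒⋢ (ℕ.≤-reflexive (sym ρy))
    ... | no ρF≰ρx with n
    ...   | zero  = contradiction (ℕ.≤-trans ρF≤ (ℕ.≤-reflexive (ℕ.+-identityʳ _))) ρF≰ρx
    ...   | suc m with interpolate x⊑F (ℕ.n≤1+n _) (ℕ.≰⇒> ρF≰ρx)
    ...     | x′ , x⊑x′ , x′⊑F , ρx′ with go m x′⊑F (ℕ.≤-trans ρF≤
                (ℕ.≤-reflexive (trans (ℕ.+-suc (ρ x) m) (cong (_+ m) (sym ρx′)))))
    ...       | G′ , x′⊑G′ , G′⊑y , ρG′ , G′⋢F
      with fourth-element x⊑x′ x′⊑G′ ρx′ (trans ρG′ (cong suc ρx′))
    ...         | w , x⊑w , w⊑G′ , ρw , w≉x′ =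
      w , x⊑w , ⊑-trans w⊑G′ G′⊑y , ρw , w⋢F
      where
      w⋢F : ¬ w ⊑ F
      w⋢F w⊑F = w≉x′ (≈-trans
        (⊑∧ρ≥⇒≈ (∧-greatest w⊑G′ w⊑F) (ℕ.≤-trans ρ∧≤ (ℕ.≤-reflexive (sym ρw))))
        (≈-sym (⊑∧ρ≥⇒≈ (∧-greatest x′⊑G′ x′⊑F) (ℕ.≤-trans ρ∧≤ (ℕ.≤-reflexive (sym ρx′))))))
        where
        ρ∧≤ : ρ (G′ ∧ F) ≤ suc (ρ x)
        ρ∧≤ = s≤s⁻¹ (ℕ.≤-trans
          (ρ-mono-< (x∧y≤x G′ F , λ e → G′⋢F (⊑-respˡ F e (x∧y≤y G′ F))))
          (ℕ.≤-reflexive (trans ρG′ (cong suc ρx′))))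

  -- The elements of rank `suc j` below `F` make up the first summand. For the second,
  -- `cover-outside` turns each `K` of rank `j` below `F` into an element outside `F` whose meet
  -- with `F` is `K`.
  level-step : ∀ j → x ⊑ F → F ⊑ y → ρ y ≡ suc (ρ F) →
    level x F (suc j) + level x F j ≤ level x y (suc j)
  level-step {x} {F} {y} j x⊑F F⊑y ρy = begin
    level x F (suc j) + level x F j     ≤⟨ ℕ.+-monoʳ-≤ _ (card-surjection (level? x F j) outside?
                                             outside-resp (_∧ F) ∧-congʳ cut) ⟩
    level x F (suc j) + card outside?   ≤⟨ card-+ (level? x F (suc j)) outside? (level? x y (suc j))
                                             (λ (x⊑z , z⊑F , ρz) → x⊑z , ⊑-trans z⊑F F⊑y , ρz)
                                             proj₁ (λ (_ , z⊑F , _) (_ , z⋢F) → z⋢F z⊑F) ⟩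
    level x y (suc j)                   ∎
    where
    open ℕ.≤-Reasoning
    Outside : Pred Carrier _
    Outside z = InLevel x y (suc j) z × ¬ z ⊑ F
    outside? : Decidable Outside
    outside? z = level? x y (suc j) z ×-dec ¬? (z ⊑? F)
    outside-resp : Outside Respects _≈_
    outside-resp e (lz , z⋢F) = level-resp x y (suc j) e lz , z⋢F ∘ ⊑-respˡ F (≈-sym e)
    ∧-congʳ : ∀ {u v} → u ≈ v → u ∧ F ≈ v ∧ F
    ∧-congʳ {u} {v} u≈v = ⊑-antisym
      (∧-greatest (⊑-respʳ (u ∧ F) u≈v (x∧y≤x u F)) (x∧y≤y u F))
      (∧-greatest (⊑-respʳ (v ∧ F) (≈-sym u≈v) (x∧y≤x v F)) (x∧y≤y v F))
    cut : ∀ {K} → InLevel x F j K → ∃ λ G → Outside G × G ∧ F ≈ K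
    cut {K} (x⊑K , K⊑F , ρK) with cover-outside F⊑y ρy K⊑F
    ... | G , K⊑G , G⊑y , ρG , G⋢F =
      G , ((⊑-trans x⊑K K⊑G , G⊑y , trans ρG (cong suc ρK)) , G⋢F)
        -- `K ⊑ G ∧ F ⊏ G`, and `ρ G` exceeds `ρ K` by one, so the meet is `K`.
        , ≈-sym (⊑∧ρ≥⇒≈ (∧-greatest K⊑G K⊑F) (s≤s⁻¹ (ℕ.≤-trans
            (ρ-mono-< (x∧y≤x G F , λ e → G⋢F (⊑-respˡ F e (x∧y≤y G F)))) (ℕ.≤-reflexive ρG))))

  level-bottom : x ⊑ y → 1 ≤ level x y (ρ x)
  level-bottom {x} {y} x⊑y =
    card-positive (level? x y (ρ x)) (level-resp x y (ρ x)) (⊑-refl , x⊑y , refl)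

  -- At a coatom `F` of [x, y], `level-step` is the counterpart of Pascal's rule.
  level-binomial : ∀ r → x ⊑ y → ρ y ≡ r + ρ x → ∀ j → r C j ≤ level x y (j + ρ x)
  level-binomial r       x⊑y ρy zero    = level-bottom x⊑y
  level-binomial zero    x⊑y ρy (suc j) = z≤n
  level-binomial {x} {y} (suc r) x⊑y ρy (suc j)
    with interpolate x⊑y (ℕ.m≤n+m (ρ x) r) (ℕ.≤-trans (ℕ.n≤1+n _) (ℕ.≤-reflexive (sym ρy)))
  ... | F , x⊑F , F⊑y , ρF = begin
    suc r C suc j                                       ≡⟨ nCk+nC[k+1]≡[n+1]C[k+1] r j ⟨
    r C j + r C suc j                                   ≡⟨ ℕ.+-comm (r C j) _ ⟩
    r C suc j + r C j                                   ≤⟨ ℕ.+-mono-≤ (level-binomial r x⊑F ρF (suc j))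
                                                                      (level-binomial r x⊑F ρF j) ⟩
    level x F (suc (j + ρ x)) + level x F (j + ρ x)     ≤⟨ level-step (j + ρ x) x⊑F F⊑y (trans ρy (cong suc (sym ρF))) ⟩
    level x y (suc j + ρ x)                             ∎
    where open ℕ.≤-Reasoning

  -- Avoiding given elements

  -- A middle element x′ of a diamond over x that lies above z can be exchanged
  -- for the other one, since z is not below their meet x.
  coatom-avoiding : x ⊑ y → z ⊑ y → ¬ z ⊑ x → ∃ λ F → x ⊑ F × F ⊑ y × ρ y ≡ suc (ρ F) × ¬ z ⊑ F
  coatom-avoiding {x} {y} {z} x⊑y z⊑y z⋢x = go (ρ y) x⊑y z⋢x (ℕ.m≤n+m (ρ y) _)
    where
    go : ∀ n {x} → x ⊑ y → ¬ z ⊑ x → ρ y ≤ ρ x + n →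
         ∃ λ F → x ⊑ F × F ⊑ y × ρ y ≡ suc (ρ F) × ¬ z ⊑ F
    go zero {x} x⊑y z⋢x ρy≤ = contradiction
      (⊑-respʳ z (≈-sym (⊑∧ρ≥⇒≈ x⊑y (ℕ.≤-trans ρy≤ (ℕ.≤-reflexive (ℕ.+-identityʳ _))))) z⊑y) z⋢x
    go (suc n) {x} x⊑y z⋢x ρy≤ with ρ y ℕ.≟ suc (ρ x)
    ... | yes ρy = x , ⊑-refl , x⊑y , ρy , z⋢x
    ... | no ρy≢ with interpolate x⊑y (ℕ.n≤1+n _) ρx<ρy
      where
      ρx<ρy : ρ x < ρ y
      ρx<ρy = ρ-mono-< (x⊑y , λ x≈y → z⋢x (⊑-respʳ z (≈-sym x≈y) z⊑y))
    ...   | x′ , x⊑x′ , x′⊑y , ρx′ with z ⊑? x′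
    ...     | no z⋢x′ = let F , x′⊑F , rest = go n x′⊑y z⋢x′ (bound ρx′)
                        in  F , ⊑-trans x⊑x′ x′⊑F , rest
      where
      bound : ρ x′ ≡ suc (ρ x) → ρ y ≤ ρ x′ + n
      bound e = ℕ.≤-trans ρy≤ (ℕ.≤-reflexive (trans (ℕ.+-suc (ρ x) n) (cong (_+ n) (sym e))))
    ...     | yes z⊑x′
      -- `ρ y` is not `suc (ρ x)`, so `x′` lies strictly below `y` and the diamond [x, x″] fits
      -- below `y`.
      with interpolate x′⊑y (ℕ.n≤1+n _)
             (ℕ.≤∧≢⇒< (ρ-mono x′⊑y) λ e → ρy≢ (trans (sym e) ρx′))
    ...       | x″ , x′⊑x″ , x″⊑y , ρx″
      with fourth-element x⊑x′ x′⊑x″ ρx′ (trans ρx″ (cong suc ρx′))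
    ...         | w , x⊑w , w⊑x″ , ρw , w≉x′ =
      let F , w⊑F , rest = go n (⊑-trans w⊑x″ x″⊑y) z⋢w
            (ℕ.≤-trans ρy≤ (ℕ.≤-reflexive (trans (ℕ.+-suc (ρ x) n) (cong (_+ n) (sym ρw)))))
      in  F , ⊑-trans x⊑w w⊑F , rest
      where
      ρ∧≤ : ρ (w ∧ x′) ≤ ρ x
      ρ∧≤ = s≤s⁻¹ (ℕ.≤-trans (ρ-mono-< (x∧y≤x w x′ , λ e →
        w≉x′ (⊑∧ρ≥⇒≈ (⊑-respˡ x′ e (x∧y≤y w x′)) (ℕ.≤-reflexive (trans ρx′ (sym ρw))))))
        (ℕ.≤-reflexive ρw))
      z⋢w : ¬ z ⊑ w
      z⋢w z⊑w = z⋢x (⊑-respʳ z (≈-sym (⊑∧ρ≥⇒≈ (∧-greatest x⊑w x⊑x′) ρ∧≤)) (∧-greatest z⊑w z⊑x′))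

  -- Each `v` costs at most one rank: if `v ⊑ F`, a coatom of [x, F] avoiding `v` replaces `F`, and
  -- going down keeps the other elements avoided.
  avoiding : ∀ vs → x ⊑ y → All (λ v → ¬ v ⊑ x) vs →
    ∃ λ F → x ⊑ F × F ⊑ y × ρ y ≤ length vs + ρ F × All (λ v → ¬ v ⊑ F) vs
  avoiding {y = y} []       x⊑y []           = y , x⊑y , ⊑-refl , ℕ.≤-refl , []
  avoiding         (v ∷ vs) x⊑y (v⋢x ∷ vs⋢x) with avoiding vs x⊑y vs⋢x
  ... | F , x⊑F , F⊑y , ρy≤ , vs⋢F with v ⊑? F
  ...   | no v⋢F  = F , x⊑F , F⊑y , ℕ.m≤n⇒m≤1+n ρy≤ , v⋢F ∷ vs⋢F
  ...   | yes v⊑F with coatom-avoiding x⊑F v⊑F v⋢x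
  ...     | G , x⊑G , G⊑F , ρF , v⋢G =
    G , x⊑G , ⊑-trans G⊑F F⊑y
      , ℕ.≤-trans ρy≤ (ℕ.≤-reflexive (trans (cong (λ n → length vs + n) ρF) (ℕ.+-suc (length vs) _)))
      , v⋢G ∷ All.map (λ u⋢F u⊑G → u⋢F (⊑-trans u⊑G G⊑F)) vs⋢F

  -- Elements above one of several atoms

  LevelAbove : List Carrier → Carrier → ℕ → Pred Carrier _
  LevelAbove vs y j z = Any (_⊑ z) vs × z ⊑ y × ρ z ≡ j

  levelAbove? : ∀ vs y j → Decidable (LevelAbove vs y j)
  levelAbove? vs y j z = any? (_⊑? z) vs ×-dec (z ⊑? y) ×-dec (ρ z ℕ.≟ j)

  -- The elements above v but above none of the vs include those of [ v , F ],
  -- where F is an element of high rank avoiding the vs.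
  levelAbove-bound : ∀ {d} k → ρ y ≡ suc d → ∀ vs → AllPairs (λ v w → ¬ v ≈ w) vs →
    All (λ v → v ⊑ y × ρ v ≡ 1) vs → ∑C d k (length vs) ≤ card (levelAbove? vs y (suc k))
  levelAbove-bound k ρy [] [] [] = z≤n
  levelAbove-bound {y} {d} k ρy (v ∷ vs) (v≉vs ∷ vs-distinct) ((v⊑y , ρv) ∷ vs-atoms)
    -- Distinct atoms are incomparable, so the search may start at `v`.
    with avoiding vs v⊑y (All.zipWith incomparable (v≉vs , vs-atoms))
    where
    incomparable : ∀ {w} → (¬ v ≈ w) × (w ⊑ y × ρ w ≡ 1) → ¬ w ⊑ v
    incomparable (v≉w , _ , ρw) w⊑v =
      v≉w (≈-sym (⊑∧ρ≥⇒≈ w⊑v (ℕ.≤-reflexive (trans ρv (sym ρw)))))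
  ... | F , v⊑F , F⊑y , ρy≤ , vs⋢F = begin
    ∑C d k m + (d ∸ m) C k
      ≤⟨ ℕ.+-mono-≤ (levelAbove-bound k ρy vs vs-distinct vs-atoms)
                    (ℕ.≤-trans (C-monoˡ k d∸m≤) (level-binomial (ρ F ∸ 1) v⊑F ρF k)) ⟩
    card (levelAbove? vs y (suc k)) + level v F (k + ρ v)
      ≡⟨ cong (λ j → card (levelAbove? vs y (suc k)) + level v F j)
              (trans (cong (λ n → k + n) ρv) (ℕ.+-comm k 1)) ⟩
    card (levelAbove? vs y (suc k)) + level v F (suc k)
      ≤⟨ card-+ (levelAbove? vs y (suc k)) (level? v F (suc k)) (levelAbove? (v ∷ vs) y (suc k))
           (λ (above , rest) → there above , rest)
           (λ (v⊑z , z⊑F , ρz) → here v⊑z , ⊑-trans z⊑F F⊑y , ρz)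
           (λ (above , _) (_ , z⊑F , _) → not-above z⊑F vs⋢F above) ⟩
    card (levelAbove? (v ∷ vs) y (suc k)) ∎
    where
    open ℕ.≤-Reasoning
    m = length vs
    1≤ρF : 1 ≤ ρ F
    1≤ρF = subst (_≤ ρ F) ρv (ρ-mono v⊑F)
    ρF : ρ F ≡ (ρ F ∸ 1) + ρ v
    ρF = sym (trans (cong (λ n → ρ F ∸ 1 + n) ρv) (ℕ.m∸n+n≡m 1≤ρF))
    -- Avoiding `m` atoms takes at most `m` off the rank `suc d`, and [v, F] loses one more because
    -- `v` has rank 1.
    d∸m≤ : d ∸ m ≤ ρ F ∸ 1
    d∸m≤ = begin
      d ∸ m                     ≡⟨⟩
      suc d ∸ suc m             ≤⟨ ℕ.∸-monoˡ-≤ (suc m) (subst (_≤ m + ρ F) ρy ρy≤) ⟩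
      (m + ρ F) ∸ suc m         ≡⟨ cong ((m + ρ F) ∸_) (ℕ.+-comm 1 m) ⟩
      (m + ρ F) ∸ (m + 1)       ≡⟨ ℕ.[m+n]∸[m+o]≡n∸o m (ρ F) 1 ⟩
      ρ F ∸ 1                   ∎
    not-above : ∀ {z us} → z ⊑ F → All (λ u → ¬ u ⊑ F) us → ¬ Any (_⊑ z) us
    not-above z⊑F (u⋢F ∷ _)    (here u⊑z)    = u⋢F (⊑-trans u⊑z z⊑F)
    not-above z⊑F (_ ∷ us⋢F)   (there above) = not-above z⊑F us⋢F above

  -- The induction step at a coatom

  -- `F` is a coatom of [⊥, y] with `d + suc t` atoms below it, and `boundF` is the bound for
  -- [⊥, F], where `suc t` takes the place of `s`.
  module AddCoatom {d t y F} (ρy : ρ y ≡ suc (suc d)) (ρF : ρ F ≡ suc d) (F⊑y : F ⊑ y)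
    (atomsF : suc d + t ≡ level ⊥ F 1)
    (boundF : ∀ k → d C suc k + ∑C d k (suc t) ≤ level ⊥ F (suc k)) where
    open ℕ.≤-Reasoning

    New : Pred Carrier _
    New z = InLevel ⊥ y 1 z × ¬ z ⊑ F
    new? : Decidable New
    new? z = level? ⊥ y 1 z ×-dec ¬? (z ⊑? F)

    new : List Carrier
    new = map element (indices new?)

    new-distinct : AllPairs (λ v w → ¬ v ≈ w) new
    new-distinct = AllPairs.map⁺ (AllPairs.map (λ i≢j i≈j → i≢j (element-injective i≈j)) (indices-unique new?))

    new-All : All New new
    new-All = All.map⁺ (All.tabulate (∈-indices⁻ new?))

    above⋢F : ∀ {z vs} → All New vs → Any (_⊑ z) vs → ¬ z ⊑ F
    above⋢F ((_ , v⋢F) ∷ _) (here v⊑z)    z⊑F = v⋢F (⊑-trans v⊑z z⊑F)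
    above⋢F (_ ∷ vs-new)    (there above) z⊑F = above⋢F vs-new above z⊑F

    -- Every atom of [⊥, y] is below `F` or new, and `suc d + t` of them are below `F`.
    new-count : ∀ {s} → level ⊥ y 1 ≡ suc d + (t + s) → s ≤ length new
    new-count {s} atoms = ℕ.+-cancelˡ-≤ (suc d + t) _ _ (begin
      (suc d + t) + s                  ≡⟨ ℕ.+-assoc (suc d) t s ⟩
      suc d + (t + s)                  ≡⟨ atoms ⟨
      level ⊥ y 1                      ≤⟨ card-∪ (level? ⊥ F 1) new? (level? ⊥ y 1) split ⟩
      level ⊥ F 1 + card new?          ≡⟨ cong₂ _+_ atomsF (List.length-map element (indices new?)) ⟨
      (suc d + t) + length new         ∎)
      where
      split : ∀ {z} → InLevel ⊥ y 1 z → InLevel ⊥ F 1 z ⊎ New z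
      split {z} lz@(⊥⊑z , _ , ρz) with z ⊑? F
      ... | yes z⊑F = inj₁ (⊥⊑z , z⊑F , ρz)
      ... | no  z⋢F = inj₂ (lz , z⋢F)

    -- This is the case `s = suc t`. Pascal's rule on both terms splits the bound into those for `F`
    -- in two consecutive ranks, which `level-step` adds up.
    one-missing : ∀ k → suc d C suc (suc k) + ∑C (suc d) (suc k) (suc t) ≤ level ⊥ y (suc (suc k))
    one-missing k = begin
      suc d C suc K + ∑C (suc d) (suc k) (suc t)
        ≤⟨ ℕ.+-mono-≤ (ℕ.≤-reflexive (sym (nCk+nC[k+1]≡[n+1]C[k+1] d K))) (∑C-pascal d k (suc t)) ⟩
      (d C K + d C suc K) + (∑C d K (suc t) + ∑C d k (suc t))
        ≡⟨ regroup (d C K) _ _ _ ⟩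
      (d C suc K + ∑C d K (suc t)) + (d C K + ∑C d k (suc t))
        ≤⟨ ℕ.+-mono-≤ (boundF K) (boundF k) ⟩
      level ⊥ F (suc K) + level ⊥ F K
        ≤⟨ level-step K (minimum F) F⊑y (trans ρy (cong suc (sym ρF))) ⟩
      level ⊥ y (suc K) ∎
      where
      K = suc k
      regroup : ∀ a b c e → (a + b) + (c + e) ≡ (b + c) + (a + e)
      regroup = solve-∀
    -- Here `F` misses `p + 2` atoms. Elements above a missed atom are not below `F`, so the bounds
    -- `boundF` and `levelAbove-bound` add up; `∑C-split` redistributes the summands between them.
    many-missing : ∀ K p → level ⊥ y 1 ≡ suc d + (suc t + suc p) →
      suc d C suc K + ∑C (suc d) K (suc (t + suc p)) ≤ level ⊥ y (suc K)
    many-missing K p atoms = begin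
      suc d C suc K + ∑C (suc d) K (suc (t + suc p))
        ≡⟨ cong₂ _+_ (sym (nCk+nC[k+1]≡[n+1]C[k+1] d K)) (∑C-head d K (t + suc p)) ⟩
      (d C K + d C suc K) + (suc d C K + ∑C d K (t + suc p))
        ≡⟨ regroup₁ (d C K) _ _ _ ⟩
      (d C suc K + suc d C K) + (d C K + ∑C d K (t + suc p))
        ≤⟨ ℕ.+-monoʳ-≤ (d C suc K + suc d C K) (∑C-split d K t p) ⟩
      (d C suc K + suc d C K) + (∑C d K (suc t) + ∑C d K (suc p))
        ≡⟨ regroup₂ (d C suc K) _ _ _ ⟩
      (d C suc K + ∑C d K (suc t)) + (suc d C K + ∑C d K (suc p))
        -- Restoring the leading `suc d C K` gives `p + 2` summands, one per new atom.
        ≡⟨ cong (λ n → (d C suc K + ∑C d K (suc t)) + n) (∑C-head d K (suc p)) ⟨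
      (d C suc K + ∑C d K (suc t)) + ∑C (suc d) K (suc (suc p))
        ≤⟨ ℕ.+-mono-≤ (boundF K) (ℕ.≤-trans
             (∑C-monoʳ (suc d) K (new-count (trans atoms (cong (λ n → suc d + n) (sym (ℕ.+-suc t (suc p)))))))
             (levelAbove-bound K ρy new new-distinct
               (All.map (λ ((_ , z⊑y , ρz) , _) → z⊑y , ρz) new-All))) ⟩
      level ⊥ F (suc K) + card (levelAbove? new y (suc K))
        ≤⟨ card-+ (level? ⊥ F (suc K)) (levelAbove? new y (suc K)) (level? ⊥ y (suc K))
             (λ (⊥⊑z , z⊑F , ρz) → ⊥⊑z , ⊑-trans z⊑F F⊑y , ρz)
             (λ (_ , z⊑y , ρz) → minimum _ , z⊑y , ρz)
             (λ (_ , z⊑F , _) (above , _) → above⋢F new-All above z⊑F) ⟩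
      level ⊥ y (suc K) ∎
      where
      regroup₁ : ∀ a b c e → (a + b) + (c + e) ≡ (b + c) + (a + e)
      regroup₁ = solve-∀
      regroup₂ : ∀ a b c e → (a + b) + (c + e) ≡ (a + c) + (b + e)
      regroup₂ = solve-∀

  -- For k = 0 the bound is the number of atoms, which holds for any s and thus
  -- spares the induction the hypothesis s ≤ d, which F need not satisfy.
  level-bound : ∀ d k {y s} → ρ y ≡ suc d → level ⊥ y 1 ≡ d + s →
    d C suc k + ∑C d k s ≤ level ⊥ y (suc k)
  level-bound d zero {s = s} ρy atoms =
    ℕ.≤-reflexive (trans (cong₂ _+_ (nC1≡n d) (∑C-k≡0 d s)) (sym atoms))
  level-bound zero (suc k) {s = s} ρy atoms = ℕ.≤-trans (ℕ.≤-reflexive (∑C-d≡0 k s)) z≤n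
  level-bound (suc d) (suc k) {y} {s} ρy atoms =
    let F , _ , F⊑y , ρF = interpolate (minimum y) (ℕ.≤-trans (ℕ.≤-reflexive ρ-⊥) z≤n)
                             (ℕ.≤-trans (ℕ.n≤1+n (suc d)) (ℕ.≤-reflexive (sym ρy)))
        t , atomsF = ℕ.m≤n⇒∃[o]m+o≡n (1+d≤atoms F ρF)
        p , 1+t+p≡s = ℕ.m≤n⇒∃[o]m+o≡n (t<s F F⊑y ρF t atomsF)
    in  by-missing-atoms F F⊑y ρF t atomsF p 1+t+p≡s
    where
    open ℕ.≤-Reasoning
    1+d≤atoms : ∀ F → ρ F ≡ suc d → suc d ≤ level ⊥ F 1
    1+d≤atoms F ρF = subst₂ _≤_ (nC1≡n (suc d)) (cong (λ j → level ⊥ F (suc j)) ρ-⊥)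
      (level-binomial (suc d) (minimum F)
        (trans ρF (sym (trans (cong (λ n → suc d + n) ρ-⊥) (ℕ.+-identityʳ _)))) 1)

    -- `level-step` at rank 0: `⊥` is the meet with `F` of some atom of [⊥, y] outside `F`.
    t<s : ∀ F → F ⊑ y → ρ F ≡ suc d → ∀ t → suc d + t ≡ level ⊥ F 1 → suc t ≤ s
    t<s F F⊑y ρF t atomsF = ℕ.+-cancelˡ-≤ (suc d) _ _ (begin
      suc d + suc t                    ≡⟨ ℕ.+-suc (suc d) t ⟩
      suc (suc d + t)                  ≡⟨ cong suc atomsF ⟩
      suc (level ⊥ F 1)                ≡⟨ ℕ.+-comm 1 _ ⟩
      level ⊥ F 1 + 1                  ≤⟨ ℕ.+-monoʳ-≤ _ (subst (λ j → 1 ≤ level ⊥ F j) ρ-⊥ (level-bottom (minimum F))) ⟩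
      level ⊥ F 1 + level ⊥ F 0        ≤⟨ level-step 0 (minimum F) F⊑y (trans ρy (cong suc (sym ρF))) ⟩
      level ⊥ y 1                      ≡⟨ atoms ⟩
      suc d + s                        ∎)

    -- `F` misses `(suc d + s) - (suc d + t) = suc p` atoms; `p = 0` is the case of a single one.
    by-missing-atoms : ∀ F → F ⊑ y → ρ F ≡ suc d → ∀ t → suc d + t ≡ level ⊥ F 1 →
      ∀ p → suc t + p ≡ s → suc d C suc (suc k) + ∑C (suc d) (suc k) s ≤ level ⊥ y (suc (suc k))
    by-missing-atoms F F⊑y ρF t atomsF = λ where
        zero    refl → subst (λ n → suc d C suc (suc k) + ∑C (suc d) (suc k) n ≤ level ⊥ y (suc (suc k)))
                         (sym (ℕ.+-identityʳ (suc t))) (one-missing k)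
        (suc p) refl → many-missing (suc k) p atoms
      where
      open AddCoatom ρy ρF F⊑y atomsF
        -- The `suc d + t` atoms below `F` are read as `d + suc t`, as the smaller rank requires.
        (λ k → level-bound d k ρF (trans (sym atomsF) (sym (ℕ.+-suc d t))))

-- The bound in terms of `φ`

-- By `∑C-telescope` the first binomial coefficient has the subtracted one as a summand, so the
-- truncated subtraction cancels exactly.
φ-ℕ : ∀ k d {s} → s ≤ suc d → φ (+ k) d s ≡ d C suc k + ∑C d k s
φ-ℕ k d {s} s≤1+d rewrite ℕ.+-comm k 1 | ℕ.+-comm d 1 = begin
  (suc d C suc k + d C suc k) ∸ X              ≡⟨ cong (λ n → (n + d C suc k) ∸ X) (∑C-telescope d k s≤1+d) ⟩
  ((∑C d k s + X) + d C suc k) ∸ X             ≡⟨ cong (_∸ X) (rotate (∑C d k s) X _) ⟩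
  ((d C suc k + ∑C d k s) + X) ∸ X             ≡⟨ ℕ.m+n∸n≡m _ X ⟩
  d C suc k + ∑C d k s                         ∎
  where
  open Relation.Binary.PropositionalEquality.≡-Reasoning
  X = (suc d ∸ s) C suc k
  rotate : ∀ a b c → (a + b) + c ≡ (c + a) + b
  rotate = solve-∀

theorem3p6 : ∀ {c ℓ₁ ℓ₂ : Level} (d s : ℕ) → d ≥ s → s ≥ 1 →
    (L : DiamondLattice c ℓ₁ ℓ₂) →
    DiamondLattice.rank L ≡ d + 1 →
    DiamondLattice.atomCount L ≡ d + s →
    (k : ℤ) → -1ℤ ℤ.≤ k → k ℤ.≤ + d →
    DiamondLattice.f L k ≥ φ k d s
theorem3p6 d s d≥s _ L rank≡ atoms≡ (-[1+ suc _ ]) (ℤ.-≤- ()) _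
-- For `k = -1` all three binomial coefficients are 1, so `φ` is 1, and `⊥` has rank 0.
theorem3p6 d s d≥s _ L rank≡ atoms≡ (-[1+ 0 ]) _ _ =
  card-positive (λ x → + ρ x ℤ.≟ + 0) (λ x≈y ρx≡0 → trans (cong +_ (sym (ρ-cong x≈y))) ρx≡0) (cong +_ ρ-⊥)
  where
  open DiamondLattice L using (finiteLattice; ρ; ρ-cong; ρ-⊥)
  open Counting finiteLattice
theorem3p6 d s d≥s _ L rank≡ atoms≡ (+ k) _ _ = begin
  φ (+ k) d s                 ≡⟨ φ-ℕ k d (ℕ.m≤n⇒m≤1+n d≥s) ⟩
  d C suc k + ∑C d k s        ≤⟨ level-bound d k (trans rank≡ (ℕ.+-comm d 1)) (trans level1≡atoms atoms≡) ⟩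
  level ⊥ ⊤ (suc k)           ≤⟨ card-mono (level? ⊥ ⊤ (suc k)) (λ x → + ρ x ℤ.≟ + k ℤ.+ + 1)
                                   (λ (_ , _ , ρz) → cong +_ (trans ρz (ℕ.+-comm 1 k))) ⟩
  f (+ k)                     ∎
  where
  open DiamondLattice L using (finiteLattice; minimum; maximum; ⊥; ⊤; ρ; f; atomCount)
  open Counting finiteLattice
  open Diamond L
  open ℕ.≤-Reasoning
  level1≡atoms : level ⊥ ⊤ 1 ≡ atomCount
  level1≡atoms = ℕ.≤-antisym
    (card-mono (level? ⊥ ⊤ 1) (λ x → ρ x ℕ.≟ 1) (λ (_ , _ , ρz) → ρz))
    (card-mono (λ x → ρ x ℕ.≟ 1) (level? ⊥ ⊤ 1) (λ ρz → minimum _ , maximum _ , ρz))
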